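{- Let $p$ be a prime and $w\ge1$ an integer. Then the number of Scopes families is $\frac1p\binom{pw}{p-1}$.
   Context: Let $\mathscr C_p=\{(c_0,\ldots,c_{p-1})\in\mathbb Z^p:\sum c_j=0\}$. For $1\le j\le p-1$, $c\in\mathscr C_p$ is $j$-allowed if $c_j-c_{j-1}\ge w$, and then $\mathrm{sc}_j(c)$ is $c$ with coordinates $c_{j-1}$ and $c_j$ interchanged. $c$ is $0$-allowed if $c_0-c_{p-1}>w$, and then $\mathrm{sc}_0(c)=(c_{p-1}+1,c_1,\ldots,c_{p-2},c_0-1)$. The Scopes families (for $p$ and $w$) are the equivalence classes of the equivalence relation on $\mathscr C_p$ generated by $c\sim\mathrm{sc}_j(c)$ for all $0\le j\le p-1$ and all $j$-allowed $c$. (Here $\mathscr C_p$ parametrizes $p$-core partitions, and Scopes families correspond to classes of $p$-blocks of symmetric groups of weight $w$.) -}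

module Defs where

open import Data.Nat as ℕ using (ℕ; zero; suc)
open import Data.Integer as ℤ using (ℤ; +_; _+_; _-_; _≤_; _<_)
open import Data.Fin using (Fin; toℕ)
open import Data.Vec using (Vec; []; _∷_; lookup; _[_]≔_)
open import Data.Product using (Σ; ∃; ∃-syntax; _×_)
open import Relation.Binary.PropositionalEquality using (_≡_)
open import Relation.Binary.Construct.Closure.Equivalence using (EqClosure)

sumℤ : ∀ {n} → Vec ℤ n → ℤ
sumℤ []       = + 0
sumℤ (x ∷ xs) = x + sumℤ xs

InC : (p : ℕ) → Vec ℤ p → Set
InC p c = sumℤ c ≡ + 0

data ScStep {p : ℕ} (w : ℕ) : Vec ℤ p → Vec ℤ p → Set where
  scj : (c : Vec ℤ p) (i j : Fin p) → toℕ j ≡ suc (toℕ i) →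
        + w ≤ lookup c j - lookup c i →
        ScStep w c ((c [ i ]≔ lookup c j) [ j ]≔ lookup c i)
  sc0 : (c : Vec ℤ p) (z l : Fin p) → toℕ z ≡ 0 → suc (toℕ l) ≡ p →
        + w < lookup c z - lookup c l →
        ScStep w c ((c [ z ]≔ (lookup c l + + 1)) [ l ]≔ (lookup c z - + 1))

ScopesEquiv : (p w : ℕ) → Vec ℤ p → Vec ℤ p → Set
ScopesEquiv p w = EqClosure (ScStep {p} w)

NumScopesFamilies : (p w N : ℕ) → Set
NumScopesFamilies p w N =
  Σ (Fin N → Vec ℤ p) λ rep →
    ((a : Fin N) → InC p (rep a)) ×
    ((a b : Fin N) → ScopesEquiv p w (rep a) (rep b) → a ≡ b) ×
    ((c : Vec ℤ p) → InC p c → ∃[ a ] ScopesEquiv p w c (rep a))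

{-# OPTIONS --safe #-}
-- Extend c to all of ℤ by c_{j+p} = c_j − 1. Every sc_j then interchanges neighbours a, b with
-- b − a ≥ w, simultaneously in all translates, so shifting the index by one (ρ below) is an
-- automorphism of the rewriting relation c → sc_j(c). Two overlapping interchanges a, b, c → c, b, a
-- satisfy the braid relation, disjoint ones commute, and Σ (p c_j + j)² decreases; by Newman's lemma
-- every family contains exactly one irreducible c.
--
-- Irreducible means c_j − c_{j−1} ≤ w − 1 for 1 ≤ j < p and c_0 − c_{p−1} ≤ w. Up to translation by
-- (1, …, 1) such c correspond to the slacks u_j = w − 1 − (c_j − c_{j−1}) ≥ 0 (1 ≤ j < p), subject to
-- Σ u_j ≤ (p − 1)(w − 1) + w, so there are C(pw, p − 1) of them with coordinate sum in {0, …, p − 1}.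
-- The shift ρ lowers the coordinate sum by one, so each of the p sums occurs equally often.
module Submission where

open import Defs
open import Algebra.Bundles using (module AbelianGroup)
open import Data.Fin using (zero; suc; toℕ; fromℕ)
open import Data.Fin.Properties using (toℕ-injective; toℕ-fromℕ)
open import Data.Integer as ℤ using (ℤ; +_; -[1+_]; _+_; _-_; _*_; -_; ∣_∣; _/ℕ_; _%ℕ_; _≤_; _<_; +≤+; +<+)
open import Data.Integer.DivMod using (n%ℕd<d; a≡a%ℕn+[a/ℕn]*n)
import Data.Integer.Properties as ℤ
open import Data.Integer.Tactic.RingSolver using (solve-∀)
open import Data.List using (List; []; _∷_; _++_; map; filter; length; lookup)
open import Data.List.Membership.Propositional using (_∈_)
open import Data.List.Membership.Propositional.Properties using (∈-map⁺; ∈-map⁻; ∈-++⁺ˡ; ∈-++⁺ʳ; ∈-++⁻; ∈-filter⁺; ∈-filter⁻; ∈-lookup)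
open import Data.List.Membership.Propositional.Properties.WithK using (unique∧set⇒bag)
open import Data.List.Properties using (length-map; length-++)
open import Data.List.Relation.Binary.BagAndSetEquality using (∼bag⇒↭)
open import Data.List.Relation.Binary.Disjoint.Propositional using (Disjoint)
open import Data.List.Relation.Binary.Permutation.Propositional.Properties using (↭-length)
import Data.List.Relation.Unary.All as All
open import Data.List.Relation.Unary.AllPairs using ([]; _∷_)
open import Data.List.Relation.Unary.Any using (here; there; index)
open import Data.List.Relation.Unary.Any.Properties using (lookup-index)
open import Data.List.Relation.Unary.Unique.Propositional using (Unique)
import Data.List.Relation.Unary.Unique.Propositional.Properties as Unique
open import Data.Nat as ℕ using (ℕ; zero; suc)
open import Data.Nat.Combinatorics using (_C_; nCn≡1; nCk+nC[k+1]≡[n+1]C[k+1])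
import Data.Nat.Induction as ℕ
open import Data.Nat.Primality using (Prime; ¬prime[0]; ¬prime[1])
import Data.Nat.Properties as ℕ
import Data.Nat.Tactic.RingSolver as ℕ
open import Data.Product using (∃; ∃-syntax; ∃₂; _×_; _,_; proj₁; proj₂)
open import Data.Sum using (inj₁; inj₂)
open import Data.Vec as Vec using (Vec; []; _∷_; _∷ʳ_; init; last; initLast; sum; _[_]≔_)
open import Data.Vec.Properties using (init-∷ʳ; last-∷ʳ; ∷-injective; ∷-injectiveʳ)
open import Function using (_∘_; flip; mk⇔)
open import Induction.WellFounded using (Acc; acc; module Subrelation)
open import Level using (0ℓ)
open import Relation.Binary using (Rel)
import Relation.Binary.Construct.Closure.Equivalence as EqClosure
open import Relation.Binary.Construct.Closure.ReflexiveTransitive as Star using (Star; ε; _◅_)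
open import Relation.Binary.Construct.Closure.Symmetric using (fwd)
open import Relation.Binary.Construct.Closure.Transitive using (Plus; [_]; _∼⁺⟨_⟩_)
import Relation.Binary.Construct.On as On
open import Relation.Binary.PropositionalEquality using (_≡_; refl; sym; trans; cong; cong₂; subst; subst₂; module ≡-Reasoning)
open import Relation.Binary.Rewriting
open import Relation.Nullary using (¬_; contradiction; Dec; yes; no)
open import Algebra.Properties.Group (AbelianGroup.group ℤ.+-0-abelianGroup) using (∙-cancelˡ)

-- The index shift and its inverse

private
  variable
    n : ℕ

ρ : Vec ℤ (suc n) → Vec ℤ (suc n)
ρ (x ∷ v) = v ∷ʳ (x - + 1)

σ : Vec ℤ (suc n) → Vec ℤ (suc n)
σ c = (last c + + 1) ∷ init c

x-1+1 : ∀ x → x - + 1 + + 1 ≡ x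
x-1+1 = solve-∀

x+1-1 : ∀ x → x + + 1 - + 1 ≡ x
x+1-1 = solve-∀

σ-∷ʳ : (v : Vec ℤ n) (x : ℤ) → σ (v ∷ʳ x) ≡ (x + + 1) ∷ v
σ-∷ʳ v x = cong₂ (λ y u → (y + + 1) ∷ u) (last-∷ʳ x v) (init-∷ʳ x v)

σ∘ρ : (c : Vec ℤ (suc n)) → σ (ρ c) ≡ c
σ∘ρ (x ∷ v) = trans (σ-∷ʳ v (x - + 1)) (cong (_∷ v) (x-1+1 x))

ρ∘σ : (c : Vec ℤ (suc n)) → ρ (σ c) ≡ c
ρ∘σ c with initLast c
... | v , x , refl = cong (v ∷ʳ_) (x+1-1 x)

σ-injective : {c d : Vec ℤ (suc n)} → σ c ≡ σ d → c ≡ d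
σ-injective {c = c} {d} eq = trans (sym (ρ∘σ c)) (trans (cong ρ eq) (ρ∘σ d))

-- Interchanges, their compatibility with the shift, and local confluence

Joinable : {A : Set} → Rel A 0ℓ → Rel A 0ℓ
Joinable R b c = ∃ λ d → Star R b d × Star R c d

module _ (w : ℕ) where

  data Swap : ∀ {n} → Vec ℤ n → Vec ℤ n → Set where
    here  : ∀ {n a b} {v : Vec ℤ n} → + w ≤ b - a → Swap (a ∷ b ∷ v) (b ∷ a ∷ v)
    there : ∀ {n x} {v v′ : Vec ℤ n} → Swap v v′ → Swap (x ∷ v) (x ∷ v′)

  Swap-∷ʳ : ∀ {v v′ : Vec ℤ n} x → Swap v v′ → Swap (v ∷ʳ x) (v′ ∷ʳ x)
  Swap-∷ʳ x (here p)  = here p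
  Swap-∷ʳ x (there s) = there (Swap-∷ʳ x s)

  Swap-last : ∀ (v : Vec ℤ n) {a b} → + w ≤ b - a → Swap (v ∷ʳ a ∷ʳ b) (v ∷ʳ b ∷ʳ a)
  Swap-last []      p = here p
  Swap-last (x ∷ v) p = there (Swap-last v p)

  -- `Swap` is read from the left while `ρ` appends on the right. The view tells whether an
  -- interchange in `v ∷ʳ x` leaves the final entry `x` alone or moves it.
  data SwapView (x : ℤ) : Vec ℤ (suc n) → Vec ℤ (suc (suc n)) → Set where
    inner : ∀ {v v′ : Vec ℤ (suc n)} → Swap v v′ → SwapView x v (v′ ∷ʳ x)
    outer : ∀ {v} (u : Vec ℤ n) y → v ≡ u ∷ʳ y → + w ≤ x - y → SwapView x v (u ∷ʳ x ∷ʳ y)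

  swapView : ∀ {x} (v : Vec ℤ (suc n)) {e} → Swap (v ∷ʳ x) e → SwapView x v e
  swapView (a ∷ [])    (here p)  = outer [] a refl p
  swapView (a ∷ [])    (there (there ()))
  swapView (a ∷ b ∷ v) (here p)  = inner (here p)
  swapView (a ∷ b ∷ v) (there s) with swapView (b ∷ v) s
  ... | inner s′          = inner (there s′)
  ... | outer u y eq p    = outer (a ∷ u) y (cong (a ∷_) eq) p

  -- sc_0 on c is conjugate under the shift ρ to the interchange of the last two entries of ρ c.
  data Step : Vec ℤ (suc (suc n)) → Vec ℤ (suc (suc n)) → Set where
    swap : ∀ {c d : Vec ℤ (suc (suc n))} → Swap c d → Step c d
    wrap : ∀ {c e : Vec ℤ (suc (suc n))} → Swap (ρ c) e → Step c (σ e)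

  wrap-≤ : ∀ a y → + w ≤ a - + 1 - y → + w ≤ a - (y + + 1)
  wrap-≤ a y = subst (+ w ≤_) (eq a y)
    where
    eq : ∀ a y → a - + 1 - y ≡ a - (y + + 1)
    eq = solve-∀

  Step-ρ : ∀ {c d : Vec ℤ (suc (suc n))} → Step c d → Step (ρ c) (ρ d)
  -- After the shift the pair sits around the end of the vector: `a - 1` is last and `b` first. A
  -- second shift puts `a - 1`, `b - 1` side by side, so the interchange is a wrap.
  Step-ρ {c = a ∷ b ∷ v} (swap (here p)) =
    subst (Step _) (σ∘ρ _) (wrap (Swap-last v (subst (+ w ≤_) (eq a b) p)))
    where
    eq : ∀ a b → b - a ≡ (b - + 1) - (a - + 1)
    eq = solve-∀
  Step-ρ (swap (there s)) = swap (Swap-∷ʳ _ s)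
  Step-ρ (wrap {e = e} s) = subst (Step _) (sym (ρ∘σ e)) (swap s)

  Step-σ : ∀ {c d : Vec ℤ (suc (suc n))} → Step c d → Step (σ c) (σ d)
  Step-σ {c = c} (swap s) = wrap (subst (λ t → Swap t _) (sym (ρ∘σ c)) s)
  Step-σ {c = a ∷ v} (wrap s) with swapView v s
  ... | inner {v′ = v′} s′ =
    subst (λ t → Step (σ (a ∷ v)) (σ t)) (sym (σ∘ρ (a ∷ v′))) (Step-σ (swap (there s′)))
  -- The wrap exchanges `a - 1` with the last entry `y`; in the window `σ (a ∷ v)` this is the pair
  -- `y + 1`, `a` at the front, hence an ordinary interchange.
  ... | outer u y refl p =
    subst₂ Step
      (sym (σ-∷ʳ (a ∷ u) y))
      (trans (cong₂ (λ z t → z ∷ (y + + 1) ∷ t)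
                    (trans (sym (x-1+1 a)) (cong (_+ + 1) (sym (last-∷ʳ (a - + 1) u))))
                    (sym (init-∷ʳ (a - + 1) u)))
             (cong σ (sym (σ-∷ʳ (u ∷ʳ (a - + 1)) y))))
      (swap (here (wrap-≤ a y p)))

  private
    ≤-cat : ∀ a b c → + w ≤ b - a → + w ≤ c - b → + w ≤ c - a
    ≤-cat a b c p q = begin
      + w             ≡⟨ ℤ.+-identityʳ (+ w) ⟨
      + w + + 0       ≤⟨ ℤ.+-mono-≤ q (ℤ.≤-trans (+≤+ ℕ.z≤n) p) ⟩
      c - b + (b - a) ≡⟨ eq a b c ⟩
      c - a           ∎
      where
      open ℤ.≤-Reasoning
      eq : ∀ a b c → c - b + (b - a) ≡ c - a
      eq = solve-∀

  Swap-there* : ∀ {x} {v v′ : Vec ℤ n} → Star Swap v v′ → Star Swap (x ∷ v) (x ∷ v′)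
  Swap-there* = Star.gmap (_ ∷_) there

  -- The only overlap is a, b, c with b - a ≥ w and c - b ≥ w. Both paths end in c, b, a and both
  -- interchange a and c on the way, which `≤-cat` permits because b - a ≥ 0.
  Swap-weaklyConfluent : WeaklyConfluent (Swap {n})
  Swap-weaklyConfluent (here p) (here q) = _ , ε , ε
  Swap-weaklyConfluent {A = a ∷ b ∷ c ∷ _} (here p) (there (here q)) =
    _ , there (here (≤-cat a b c p q)) ◅ here q ◅ ε , here (≤-cat a b c p q) ◅ there (here p) ◅ ε
  Swap-weaklyConfluent (here p) (there (there t)) =
    _ , there (there t) ◅ ε , here p ◅ ε
  Swap-weaklyConfluent {A = a ∷ b ∷ c ∷ _} (there (here p)) (here q) =
    _ , here (≤-cat a b c q p) ◅ there (here q) ◅ ε , there (here (≤-cat a b c q p)) ◅ here p ◅ ε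
  Swap-weaklyConfluent (there (there s)) (here q) =
    _ , here q ◅ ε , there (there s) ◅ ε
  Swap-weaklyConfluent (there s) (there t) with Swap-weaklyConfluent s t
  ... | _ , ss , ts = _ , Swap-there* ss , Swap-there* ts

  -- Here `c` stands for the shifted source `ρ` of two wraps: they are joined in that window, and
  -- the joining paths are carried back by `σ`.
  wraps-join : ∀ {c d e : Vec ℤ (suc (suc n))} →
               Swap c d → Swap c e → Joinable Step (σ d) (σ e)
  wraps-join s t with Swap-weaklyConfluent s t
  ... | _ , ss , ts = _ , Star.gmap σ (Step-σ ∘ swap) ss , Star.gmap σ (Step-σ ∘ swap) ts

  swaps-join : ∀ {c d e : Vec ℤ (suc (suc n))} →
               Swap c d → Swap c e → Joinable Step d e
  swaps-join s t with Swap-weaklyConfluent s t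
  ... | _ , ss , ts = _ , Star.map swap ss , Star.map swap ts

  -- The cases look for a window in which both interchanges are ordinary. It is `ρ c` if the first
  -- one avoids the first entry of `c`, it is `c` if the second one avoids the appended entry, and
  -- otherwise it is `σ c`.
  swap-wrap-join : ∀ {c d e : Vec ℤ (suc (suc n))} →
                   Swap c d → Swap (ρ c) e → Joinable Step d (σ e)
  swap-wrap-join {c = x ∷ v} {e = e} (there {v′ = v′} s) t =
    subst (λ b → Joinable Step b (σ e)) (σ∘ρ (x ∷ v′)) (wraps-join (Swap-∷ʳ _ s) t)
  swap-wrap-join {c = a ∷ b ∷ v} (here p) t with swapView (b ∷ v) t
  ... | inner {v′ = v′} t′ =
    subst (Joinable Step _) (sym (σ∘ρ (a ∷ v′))) (swaps-join (here p) (there t′))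
  -- For p = 2 both interchanges would concern the same pair in opposite directions. The two
  -- differences are at least w ≥ 0, yet they add up to -1.
  ... | outer [] y refl q = contradiction 0≤-1 λ ()
    where
    eq : ∀ a b → b - a + (a - + 1 - b) ≡ - + 1
    eq = solve-∀
    0≤-1 : + 0 ≤ - + 1
    0≤-1 = subst (+ 0 ≤_) (eq a b) (ℤ.+-mono-≤ (ℤ.≤-trans (+≤+ ℕ.z≤n) p) (ℤ.≤-trans (+≤+ ℕ.z≤n) q))
  -- The first two and the last entry of c are involved: they are consecutive in σ c.
  ... | outer (.b ∷ u) y refl q =
    let _ , ss , ts = Swap-weaklyConfluent (there {x = y + + 1} (here {v = u} p)) (here (wrap-≤ a y q))
    in  subst₂ (Joinable Step)
          (cong (λ z → b ∷ a ∷ (u ∷ʳ z)) (x+1-1 y))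
          (sym (σ-∷ʳ (b ∷ (u ∷ʳ (a - + 1))) y))
          (_ , Star.gmap ρ (Step-ρ ∘ swap) ss , Star.gmap ρ (Step-ρ ∘ swap) ts)

  Step-weaklyConfluent : WeaklyConfluent (Step {n})
  Step-weaklyConfluent (swap s) (swap t) = swaps-join s t
  Step-weaklyConfluent (swap s) (wrap t) = swap-wrap-join s t
  Step-weaklyConfluent (wrap s) (swap t) =
    let _ , ts , ss = swap-wrap-join t s in _ , ss , ts
  Step-weaklyConfluent (wrap s) (wrap t) = wraps-join s t

-- Coordinate sums and the comparison with ScStep

sumℤ-∷ʳ : (v : Vec ℤ n) (x : ℤ) → sumℤ (v ∷ʳ x) ≡ sumℤ v + x
sumℤ-∷ʳ []      x = ℤ.+-comm x (+ 0)
sumℤ-∷ʳ (y ∷ v) x = trans (cong (λ s → y + s) (sumℤ-∷ʳ v x)) (sym (ℤ.+-assoc y (sumℤ v) x))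

sumℤ-ρ : (c : Vec ℤ (suc n)) → sumℤ (ρ c) ≡ sumℤ c - + 1
sumℤ-ρ (x ∷ v) = trans (sumℤ-∷ʳ v (x - + 1)) (eq x (sumℤ v))
  where
  eq : ∀ x s → s + (x - + 1) ≡ x + s - + 1
  eq = solve-∀

sumℤ-σ : (c : Vec ℤ (suc n)) → sumℤ (σ c) ≡ sumℤ c + + 1
sumℤ-σ c = begin
  sumℤ (σ c)              ≡⟨ x-1+1 (sumℤ (σ c)) ⟨
  sumℤ (σ c) - + 1 + + 1  ≡⟨ cong (_+ + 1) (sumℤ-ρ (σ c)) ⟨
  sumℤ (ρ (σ c)) + + 1    ≡⟨ cong (λ d → sumℤ d + + 1) (ρ∘σ c) ⟩
  sumℤ c + + 1            ∎
  where open ≡-Reasoning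

lookup-∷ʳ-fromℕ : ∀ (v : Vec ℤ n) x → Vec.lookup (v ∷ʳ x) (fromℕ n) ≡ x
lookup-∷ʳ-fromℕ []      x = refl
lookup-∷ʳ-fromℕ (y ∷ v) x = lookup-∷ʳ-fromℕ v x

update-∷ʳ-fromℕ : ∀ (v : Vec ℤ n) x y → (v ∷ʳ x) [ fromℕ n ]≔ y ≡ v ∷ʳ y
update-∷ʳ-fromℕ []      x y = refl
update-∷ʳ-fromℕ (z ∷ v) x y = cong (z ∷_) (update-∷ʳ-fromℕ v x y)

0≤i*i : ∀ i → + 0 ≤ i * i
0≤i*i (+ n)    = subst (+ 0 ≤_) (ℤ.pos-* n n) (+≤+ ℕ.z≤n)
0≤i*i -[1+ n ] = +≤+ ℕ.z≤n

module _ (w : ℕ) where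

  sumℤ-Swap : ∀ {c d : Vec ℤ n} → Swap w c d → sumℤ c ≡ sumℤ d
  sumℤ-Swap {c = a ∷ b ∷ v} (here _) = eq a b (sumℤ v)
    where
    eq : ∀ a b s → a + (b + s) ≡ b + (a + s)
    eq = solve-∀
  sumℤ-Swap (there {x = x} s) = cong (λ t → x + t) (sumℤ-Swap s)

  sumℤ-Step : ∀ {c d : Vec ℤ (suc (suc n))} → Step w c d → sumℤ c ≡ sumℤ d
  sumℤ-Step (swap s) = sumℤ-Swap s
  sumℤ-Step {c = c} (wrap {e = e} s) = begin
    sumℤ c                ≡⟨ x-1+1 (sumℤ c) ⟨
    sumℤ c - + 1 + + 1    ≡⟨ cong (_+ + 1) (sumℤ-ρ c) ⟨
    sumℤ (ρ c) + + 1      ≡⟨ cong (_+ + 1) (sumℤ-Swap s) ⟩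
    sumℤ e + + 1          ≡⟨ sumℤ-σ e ⟨
    sumℤ (σ e)            ∎
    where open ≡-Reasoning

  scj⇒Swap : ∀ (c : Vec ℤ n) i j → toℕ j ≡ suc (toℕ i) → + w ≤ Vec.lookup c j - Vec.lookup c i →
             Swap w c ((c [ i ]≔ Vec.lookup c j) [ j ]≔ Vec.lookup c i)
  scj⇒Swap (a ∷ b ∷ v) zero    (suc zero) eq p = here p
  scj⇒Swap (a ∷ v)     (suc i) (suc j)    eq p = there (scj⇒Swap v i j (ℕ.suc-injective eq) p)

  Swap⇒scj : ∀ {c d : Vec ℤ n} → Swap w c d →
             ∃₂ λ i j → toℕ j ≡ suc (toℕ i) × + w ≤ Vec.lookup c j - Vec.lookup c i ×
                        (c [ i ]≔ Vec.lookup c j) [ j ]≔ Vec.lookup c i ≡ d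
  Swap⇒scj (here p) = zero , suc zero , refl , p , refl
  Swap⇒scj (there s) with Swap⇒scj s
  ... | i , j , eq , p , eq′ = suc i , suc j , cong suc eq , p , cong (_ ∷_) eq′

  Swap⇒ScStep : ∀ {c d : Vec ℤ n} → Swap w c d → ScStep w c d
  Swap⇒ScStep {c = c} s with Swap⇒scj s
  ... | i , j , eq , p , refl = scj c i j eq p

  ScStep⇒Step : ∀ {c d : Vec ℤ (suc (suc n))} → ScStep w c d → Step w c d
  ScStep⇒Step (scj c i j eq p) = swap (scj⇒Swap c i j eq p)
  ScStep⇒Step {n = n} (sc0 (a ∷ v) zero (suc l) _ eq p)
    with toℕ-injective {i = l} {fromℕ n}
           (trans (ℕ.suc-injective (ℕ.suc-injective eq)) (sym (toℕ-fromℕ n)))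
       | initLast v
  ... | refl | u , y , refl
    rewrite lookup-∷ʳ-fromℕ u y | update-∷ʳ-fromℕ u y (a - + 1) =
    subst (Step w _) (σ-∷ʳ (u ∷ʳ (a - + 1)) y) (wrap (Swap-last w u w≤))
    where
    eq′ : ∀ a y → - + 1 + (a - y) ≡ a - + 1 - y
    eq′ = solve-∀
    -- The strict inequality for j = 0 turns into the weak one of `Swap`, because the shift lowers
    -- `a` by one.
    w≤ : + w ≤ a - + 1 - y
    w≤ = subst (+ w ≤_) (eq′ a y) (ℤ.i<j⇒i≤pred[j] p)

  Step⇒ScStep : ∀ {c d : Vec ℤ (suc (suc n))} → Step w c d → ScStep w c d
  Step⇒ScStep (swap s) = Swap⇒ScStep s
  Step⇒ScStep {n = n} {c = a ∷ v} (wrap s) with swapView w v s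
  ... | inner {v′ = v′} s′ =
    subst (ScStep w _) (sym (σ∘ρ (a ∷ v′))) (Swap⇒ScStep (there s′))
  ... | outer u y refl p =
    subst (ScStep w _) eqv
      (sc0 (a ∷ (u ∷ʳ y)) zero (suc (fromℕ n)) refl (cong (λ k → suc (suc k)) (toℕ-fromℕ n)) w<)
    where
    eqv : (Vec.lookup (u ∷ʳ y) (fromℕ n) + + 1) ∷ ((u ∷ʳ y) [ fromℕ n ]≔ (a - + 1))
          ≡ σ (u ∷ʳ (a - + 1) ∷ʳ y)
    eqv = trans (cong₂ (λ z t → (z + + 1) ∷ t) (lookup-∷ʳ-fromℕ u y) (update-∷ʳ-fromℕ u y (a - + 1)))
                (sym (σ-∷ʳ (u ∷ʳ (a - + 1)) y))
    eq′ : ∀ a y → a - + 1 - y ≡ - + 1 + (a - y)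
    eq′ = solve-∀
    w< : + w < a - Vec.lookup (u ∷ʳ y) (fromℕ n)
    w< rewrite lookup-∷ʳ-fromℕ u y = ℤ.i≤pred[j]⇒i<j (subst (+ w ≤_) (eq′ a y) p)

  swap? : (c : Vec ℤ n) → Dec (∃ (Swap w c))
  swap? []          = no λ ()
  swap? (a ∷ [])    = no λ { (_ , there ()) }
  swap? (a ∷ b ∷ v) with + w ℤ.≤? b - a | swap? (b ∷ v)
  ... | yes p | _           = yes (_ , here p)
  ... | no  _ | yes (_ , s) = yes (_ , there s)
  ... | no ¬p | no ¬s       = no λ { (_ , here p) → ¬p p ; (_ , there s) → ¬s (_ , s) }

  step? : (c : Vec ℤ (suc (suc n))) → Dec (∃ (Step w c))
  step? c with swap? c | swap? (ρ c)
  ... | yes (_ , s) | _           = yes (_ , swap s)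
  ... | no  _       | yes (_ , s) = yes (_ , wrap s)
  ... | no ¬s       | no ¬t       = no λ { (_ , swap s) → ¬s (_ , s) ; (_ , wrap t) → ¬t (_ , t) }

-- Termination

-- energy (+ p) (+ k) c is Σ (p c_j + j + k)²; the p numbers p c_j + j are moved by −1 by ρ.
energy : ℤ → ℤ → Vec ℤ n → ℤ
energy P k []      = + 0
energy P k (x ∷ v) = (P * x + k) * (P * x + k) + energy P (k + + 1) v

0≤energy : ∀ P k (c : Vec ℤ n) → + 0 ≤ energy P k c
0≤energy P k []      = +≤+ ℕ.z≤n
0≤energy P k (x ∷ v) = ℤ.+-mono-≤ (0≤i*i (P * x + k)) (0≤energy P (k + + 1) v)

energy-∷ʳ : ∀ P k (v : Vec ℤ n) x →
            energy P k (v ∷ʳ x) ≡ energy P k v + (P * x + (k + + n)) * (P * x + (k + + n))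
energy-∷ʳ P k [] x = eq P k x
  where
  eq : ∀ P k x → (P * x + k) * (P * x + k) + + 0 ≡ + 0 + (P * x + (k + + 0)) * (P * x + (k + + 0))
  eq = solve-∀
energy-∷ʳ {suc n} P k (y ∷ v) x =
  trans (cong (λ t → (P * y + k) * (P * y + k) + t) (energy-∷ʳ P (k + + 1) v x))
        (eq P k (+ n) y (energy P (k + + 1) v) x)
  where
  eq : ∀ P k m y e x →
       (P * y + k) * (P * y + k) + (e + (P * x + (k + + 1 + m)) * (P * x + (k + + 1 + m)))
       ≡ (P * y + k) * (P * y + k) + e + (P * x + (k + (+ 1 + m))) * (P * x + (k + (+ 1 + m)))
  eq = solve-∀

-- The entry that moves to the end keeps its contribution: p (x - 1) + k + 1 + n = p x + k for p = n
-- + 1. This forces the multiplier to be the period.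
energy-ρ : ∀ k (c : Vec ℤ (suc n)) → energy (+ suc n) (k + + 1) (ρ c) ≡ energy (+ suc n) k c
energy-ρ {n} k (x ∷ v) =
  trans (energy-∷ʳ (+ suc n) (k + + 1) v (x - + 1))
        (eq (+ n) k x (energy (+ suc n) (k + + 1) v))
  where
  eq : ∀ m k x e →
       e + ((+ 1 + m) * (x - + 1) + (k + + 1 + m)) * ((+ 1 + m) * (x - + 1) + (k + + 1 + m))
       ≡ ((+ 1 + m) * x + k) * ((+ 1 + m) * x + k) + e
  eq = solve-∀

module _ (w′ : ℕ) where

  private
    w : ℕ
    w = suc w′

  -- The loss is 2P (b - a), whatever the offset `k`, and b - a ≥ w ≥ 1. The multiplier is
  -- independent of the length since the induction shortens the vector while P stays fixed.
  energy-Swap : ∀ m k {c d : Vec ℤ n} → Swap w c d → energy (+ suc m) k d < energy (+ suc m) k c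
  energy-Swap m k (there {x = x} s) =
    ℤ.+-monoʳ-< ((+ suc m * x + k) * (+ suc m * x + k)) (energy-Swap m (k + + 1) s)
  energy-Swap m k {c = a ∷ b ∷ v} (here p) = begin-strict
    E                                ≡⟨ ℤ.+-identityʳ E ⟨
    E + + 0                          <⟨ ℤ.+-monoʳ-< E 0<2P[b-a] ⟩
    E + + 2 * P * (b - a)            ≡⟨ eq P k a b (energy P (k + + 1 + + 1) v) ⟩
    energy P k (a ∷ b ∷ v)           ∎
    where
    open ℤ.≤-Reasoning
    P = + suc m
    E = energy P k (b ∷ a ∷ v)
    0<2P[b-a] : + 0 < + 2 * P * (b - a)
    0<2P[b-a] = subst (_< + 2 * P * (b - a)) (ℤ.*-zeroʳ (+ 2 * P))
      (ℤ.*-monoˡ-<-pos (+ 2 * P) {{ℤ.positive (+<+ ℕ.z<s)}} (ℤ.<-≤-trans (+<+ ℕ.z<s) p))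
    eq : ∀ P k a b e →
         (P * b + k) * (P * b + k) + ((P * a + (k + + 1)) * (P * a + (k + + 1)) + e) + + 2 * P * (b - a)
         ≡ (P * a + k) * (P * a + k) + ((P * b + (k + + 1)) * (P * b + (k + + 1)) + e)
    eq = solve-∀

  energy-Step : ∀ {c d : Vec ℤ (suc (suc n))} → Step w c d →
                energy (+ suc (suc n)) (+ 0) d < energy (+ suc (suc n)) (+ 0) c
  energy-Step {n} (swap s) = energy-Swap (suc n) (+ 0) s
  energy-Step {n} {c} (wrap {e = e} s) = begin-strict
    energy P (+ 0) (σ e)     ≡⟨ energy-ρ (+ 0) (σ e) ⟨
    energy P (+ 1) (ρ (σ e)) ≡⟨ cong (energy P (+ 1)) (ρ∘σ e) ⟩
    energy P (+ 1) e         <⟨ energy-Swap (suc n) (+ 1) s ⟩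
    energy P (+ 1) (ρ c)     ≡⟨ energy-ρ (+ 0) c ⟩
    energy P (+ 0) c         ∎
    where
    open ℤ.≤-Reasoning
    P = + suc (suc n)

  potential : Vec ℤ (suc (suc n)) → ℕ
  potential {n} c = ∣ energy (+ suc (suc n)) (+ 0) c ∣

  potential-Step : ∀ {c d : Vec ℤ (suc (suc n))} → Step w c d → potential d ℕ.< potential c
  potential-Step {n} {c} {d} s = ℤ.drop‿+<+ (subst₂ _<_
    (sym (ℤ.0≤i⇒+∣i∣≡i (0≤energy _ _ d))) (sym (ℤ.0≤i⇒+∣i∣≡i (0≤energy _ _ c))) (energy-Step s))

  potential-Step⁺ : ∀ {c d : Vec ℤ (suc (suc n))} → Plus (Step w) c d → potential d ℕ.< potential c
  potential-Step⁺ [ s ]           = potential-Step s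
  potential-Step⁺ (_ ∼⁺⟨ s ⟩ t) = ℕ.<-trans (potential-Step⁺ t) (potential-Step⁺ s)

  Step⁺-stronglyNormalizing : StronglyNormalizing (Plus (Step w {n}))
  Step⁺-stronglyNormalizing =
    Subrelation.wellFounded potential-Step⁺ (On.wellFounded potential ℕ.<-wellFounded)

  Step-uniqueNormalForm : UniqueNormalForm (Step w {n})
  Step-uniqueNormalForm = conf⇒unf (sn&wcr⇒cr Step⁺-stronglyNormalizing (Step-weaklyConfluent w))

  Step-weaklyNormalizing : WeaklyNormalizing (Step w {n})
  Step-weaklyNormalizing c = normalise c (Step⁺-stronglyNormalizing c)
    where
    normalise : ∀ c → Acc (flip (Plus (Step w))) c → HasNormalForm (Step w) c
    normalise c (acc rs) with step? w c
    ... | no  nf      = c , nf , ε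
    ... | yes (d , s) with normalise d (rs [ s ])
    ...   | e , nf , ss = e , nf , s ◅ ss

-- Counting irreducible vectors

incrHead : Vec ℕ (suc n) → Vec ℕ (suc n)
incrHead (x ∷ v) = suc x ∷ v

incrHead-injective : {u v : Vec ℕ (suc n)} → incrHead u ≡ incrHead v → u ≡ v
incrHead-injective {u = _ ∷ _} {_ ∷ _} refl = refl

-- The vectors of sum at most `m`. Splitting by whether the first entry is zero, and lowering it
-- otherwise, makes the recursion Pascal's rule for C(m + n, n).
boundedVecs : ∀ n → ℕ → List (Vec ℕ n)
boundedVecs zero    m       = [] ∷ []
boundedVecs (suc n) zero    = map (0 ∷_) (boundedVecs n zero)
boundedVecs (suc n) (suc m) = map (0 ∷_) (boundedVecs n (suc m)) ++ map incrHead (boundedVecs (suc n) m)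

length-boundedVecs : ∀ n m → length (boundedVecs n m) ≡ (m ℕ.+ n) C n
length-boundedVecs zero    m    = refl
length-boundedVecs (suc n) zero = begin
  length (map (0 ∷_) (boundedVecs n zero)) ≡⟨ length-map (0 ∷_) (boundedVecs n zero) ⟩
  length (boundedVecs n zero)              ≡⟨ length-boundedVecs n zero ⟩
  n C n                                    ≡⟨ nCn≡1 n ⟩
  1                                        ≡⟨ nCn≡1 (suc n) ⟨
  suc n C suc n                            ∎
  where open ≡-Reasoning
length-boundedVecs (suc n) (suc m) = begin
  length (map (0 ∷_) us ++ map incrHead vs)             ≡⟨ length-++ (map (0 ∷_) us) ⟩
  length (map (0 ∷_) us) ℕ.+ length (map incrHead vs)   ≡⟨ cong₂ ℕ._+_ (length-map (0 ∷_) us) (length-map incrHead vs) ⟩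
  length us ℕ.+ length vs                               ≡⟨ cong₂ ℕ._+_ (length-boundedVecs n (suc m)) (length-boundedVecs (suc n) m) ⟩
  (suc m ℕ.+ n) C n ℕ.+ (m ℕ.+ suc n) C suc n           ≡⟨ cong (λ k → (suc m ℕ.+ n) C n ℕ.+ k C suc n) (ℕ.+-suc m n) ⟩
  (suc m ℕ.+ n) C n ℕ.+ (suc m ℕ.+ n) C suc n           ≡⟨ nCk+nC[k+1]≡[n+1]C[k+1] (suc m ℕ.+ n) n ⟩
  suc (suc m ℕ.+ n) C suc n                             ≡⟨ cong (_C suc n) (ℕ.+-suc (suc m) n) ⟨
  (suc m ℕ.+ suc n) C suc n                             ∎
  where
  open ≡-Reasoning
  us = boundedVecs n (suc m)
  vs = boundedVecs (suc n) m

∈-boundedVecs⁺ : ∀ {m} (u : Vec ℕ n) → sum u ℕ.≤ m → u ∈ boundedVecs n m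
∈-boundedVecs⁺ []                    _   = here refl
∈-boundedVecs⁺ {m = zero}  (zero ∷ u)  p = ∈-map⁺ (0 ∷_) (∈-boundedVecs⁺ u p)
∈-boundedVecs⁺ {m = suc m} (zero ∷ u)  p = ∈-++⁺ˡ (∈-map⁺ (0 ∷_) (∈-boundedVecs⁺ u p))
∈-boundedVecs⁺ {m = suc m} (suc x ∷ u) (ℕ.s≤s p) =
  ∈-++⁺ʳ (map (0 ∷_) (boundedVecs _ (suc m))) (∈-map⁺ incrHead (∈-boundedVecs⁺ (x ∷ u) p))

∈-boundedVecs⁻ : ∀ n m {u : Vec ℕ n} → u ∈ boundedVecs n m → sum u ℕ.≤ m
∈-boundedVecs⁻ zero    m (here refl) = ℕ.z≤n
∈-boundedVecs⁻ (suc n) zero i with ∈-map⁻ (0 ∷_) i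
... | _ , j , refl = ∈-boundedVecs⁻ n zero j
∈-boundedVecs⁻ (suc n) (suc m) i with ∈-++⁻ (map (0 ∷_) (boundedVecs n (suc m))) i
... | inj₁ j with ∈-map⁻ (0 ∷_) j
...   | _ , k , refl = ∈-boundedVecs⁻ n (suc m) k
∈-boundedVecs⁻ (suc n) (suc m) i | inj₂ j with ∈-map⁻ incrHead j
...   | _ ∷ _ , k , refl = ℕ.s≤s (∈-boundedVecs⁻ (suc n) m k)

boundedVecs-unique : ∀ n m → Unique (boundedVecs n m)
boundedVecs-unique zero    m       = All.[] ∷ []
boundedVecs-unique (suc n) zero    = Unique.map⁺ ∷-injectiveʳ (boundedVecs-unique n zero)
boundedVecs-unique (suc n) (suc m) = Unique.++⁺
  (Unique.map⁺ ∷-injectiveʳ (boundedVecs-unique n (suc m)))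
  (Unique.map⁺ incrHead-injective (boundedVecs-unique (suc n) m))
  disjoint
  where
  disjoint : Disjoint (map (0 ∷_) (boundedVecs n (suc m))) (map incrHead (boundedVecs (suc n) m))
  disjoint (i , j) with ∈-map⁻ (0 ∷_) i | ∈-map⁻ incrHead j
  ... | _ , _ , refl | _ ∷ _ , _ , ()

unique⇒lookup-injective : ∀ {A : Set} {xs : List A} → Unique xs →
                          ∀ i j → lookup xs i ≡ lookup xs j → i ≡ j
unique⇒lookup-injective (_ ∷ _)     zero    zero    _  = refl
unique⇒lookup-injective (x∉xs ∷ _)  zero    (suc j) eq = contradiction eq (All.lookup x∉xs (∈-lookup j))
unique⇒lookup-injective (x∉xs ∷ _)  (suc i) zero    eq = contradiction (sym eq) (All.lookup x∉xs (∈-lookup i))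
unique⇒lookup-injective (_ ∷ xs!)   (suc i) (suc j) eq = cong suc (unique⇒lookup-injective xs! i j eq)

-- A positive `d` would give k′ ≥ p, a negative one k ≥ p. It serves to show that a coordinate sum
-- in {0, ..., p - 1} fixes the translate.
quotient-unique : ∀ p {k k′} d → k ℕ.< p → k′ ℕ.< p → + k + d * + p ≡ + k′ → d ≡ + 0
quotient-unique p (+ zero)     k<p k′<p eq = refl
quotient-unique p {k} {k′} (+ suc d) k<p k′<p eq = contradiction k′<p (ℕ.≤⇒≯ (begin
  p                        ≤⟨ ℕ.m≤m+n p (d ℕ.* p) ⟩
  suc d ℕ.* p              ≤⟨ ℕ.m≤n+m (suc d ℕ.* p) k ⟩
  k ℕ.+ suc d ℕ.* p        ≡⟨ ℤ.+-injective (trans (cong (λ t → + k + t) (ℤ.pos-* (suc d) p)) eq) ⟩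
  k′                       ∎))
  where open ℕ.≤-Reasoning
quotient-unique p {k} {k′} -[1+ d ] k<p k′<p eq = contradiction k<p (ℕ.≤⇒≯ (begin
  p                        ≤⟨ ℕ.m≤m+n p (d ℕ.* p) ⟩
  suc d ℕ.* p              ≤⟨ ℕ.m≤n+m (suc d ℕ.* p) k′ ⟩
  k′ ℕ.+ suc d ℕ.* p       ≡⟨ ℤ.+-injective (trans (cong (λ t → + k′ + t) (ℤ.pos-* (suc d) p))
                                (trans (cong (λ t → t + + suc d * + p) (sym eq)) (eq′ (+ k) (+ suc d) (+ p)))) ⟩
  k                        ∎))
  where
  open ℕ.≤-Reasoning
  eq′ : ∀ k d p → k + - d * p + d * p ≡ k
  eq′ = solve-∀

-- Irreducible vectors and their slacks

module _ (w′ : ℕ) where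

  private
    w : ℕ
    w = suc w′

  -- Rebuilds c from c_0 = x and the slacks u_j = w′ - (c_j - c_{j-1}), where w′ = w - 1 is the
  -- largest ascent that is not j-allowed.
  fromSlacks : ℤ → Vec ℕ n → Vec ℤ (suc n)
  fromSlacks x []       = x ∷ []
  fromSlacks x (u ∷ us) = x ∷ fromSlacks (x + + w′ - + u) us

  fromSlacks-injective : ∀ {x y} (u v : Vec ℕ n) → fromSlacks x u ≡ fromSlacks y v → x ≡ y × u ≡ v
  fromSlacks-injective []       []       refl = refl , refl
  fromSlacks-injective {x = x} (u ∷ us) (v ∷ vs) eq with ∷-injective eq
  ... | refl , eq′ with fromSlacks-injective us vs eq′
  ...   | eq″ , refl = refl , cong (_∷ us) (ℤ.+-injective (ℤ.neg-injective (∙-cancelˡ (x + + w′) _ _ eq″)))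

  ¬Swap-fromSlacks : ∀ x (u : Vec ℕ n) {d} → ¬ Swap w (fromSlacks x u) d
  ¬Swap-fromSlacks x []           (there ())
  ¬Swap-fromSlacks x (u ∷ us)     s = go us s
    where
    eq : ∀ x w′ u → x + w′ - u - x ≡ w′ - u
    eq = solve-∀
    descent : ¬ + w ≤ x + + w′ - + u - x
    descent p = ℕ.1+n≰n (ℤ.drop‿+≤+ (ℤ.≤-trans (subst (+ w ≤_) (eq x (+ w′) (+ u)) p) (ℤ.i-j≤i (+ w′) (+ u))))
    -- Splitting on `us` lets `fromSlacks` expose its second entry, without which `here` cannot be
    -- matched.
    go : ∀ {m} (us : Vec ℕ m) {d} → ¬ Swap w (fromSlacks x (u ∷ us)) d
    go []       (here p)  = descent p
    go []       (there s) = ¬Swap-fromSlacks _ [] s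
    go (_ ∷ _)  (here p)  = descent p
    go (v ∷ us) (there s) = ¬Swap-fromSlacks _ (v ∷ us) s

  ¬Swap⇒fromSlacks : ∀ x (v : Vec ℤ n) → ¬ ∃ (Swap w (x ∷ v)) → ∃ λ u → x ∷ v ≡ fromSlacks x u
  ¬Swap⇒fromSlacks a []      ¬s = [] , refl
  ¬Swap⇒fromSlacks a (b ∷ v) ¬s with ¬Swap⇒fromSlacks b v (λ (_ , s) → ¬s (_ , there s))
  ... | us , eq = u ∷ us , cong (a ∷_) (trans eq (cong (λ y → fromSlacks y us) b≡))
    where
    b-a≤w′ : b - a ≤ + w′
    b-a≤w′ = ℤ.i<j⇒i≤pred[j] (ℤ.≰⇒> (λ p → ¬s (_ , here p)))
    -- The absolute value only converts to ℕ: the slack is nonnegative by `b-a≤w′`.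
    u = ∣ + w′ - (b - a) ∣
    eq′ : ∀ a b w′ → b ≡ a + w′ - (w′ - (b - a))
    eq′ = solve-∀
    b≡ : b ≡ a + + w′ - + u
    b≡ = trans (eq′ a b (+ w′))
           (cong (λ t → a + + w′ - t) (sym (ℤ.0≤i⇒+∣i∣≡i (ℤ.i≤j⇒0≤j-i b-a≤w′))))

  last-fromSlacks : ∀ x (u : Vec ℕ n) → last (fromSlacks x u) ≡ x + + (n ℕ.* w′) - + sum u
  last-fromSlacks x []       = eq x
    where
    eq : ∀ x → x ≡ x + + 0 - + 0
    eq = solve-∀
  last-fromSlacks {suc n} x (u ∷ us) =
    trans (last-fromSlacks (x + + w′ - + u) us) (eq x (+ w′) (+ u) (+ (n ℕ.* w′)) (+ sum us))
    where
    eq : ∀ x w u nw s → x + w - u + nw - s ≡ x + (w + nw) - (u + s)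
    eq = solve-∀

  -- It makes the coordinate sum modulo the length a function of the slacks alone.
  sumℤ-fromSlacks : ∀ x y (u : Vec ℕ n) → sumℤ (fromSlacks (x + y) u) ≡ sumℤ (fromSlacks y u) + x * + suc n
  sumℤ-fromSlacks x y [] = eq x y
    where
    eq : ∀ x y → x + y + + 0 ≡ y + + 0 + x * + 1
    eq = solve-∀
  sumℤ-fromSlacks {suc n} x y (u ∷ us) = begin
    x + y + sumℤ (fromSlacks (x + y + + w′ - + u) us)
      ≡⟨ cong (λ t → x + y + sumℤ (fromSlacks t us)) (eq₁ x y (+ w′) (+ u)) ⟩
    x + y + sumℤ (fromSlacks (x + (y + + w′ - + u)) us)
      ≡⟨ cong (λ t → x + y + t) (sumℤ-fromSlacks x (y + + w′ - + u) us) ⟩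
    x + y + (s + x * + suc n)
      ≡⟨ eq₂ x y s (+ suc n) ⟩
    y + s + x * + suc (suc n) ∎
    where
    open ≡-Reasoning
    s = sumℤ (fromSlacks (y + + w′ - + u) us)
    eq₁ : ∀ x y w u → x + y + w - u ≡ x + (y + w - u)
    eq₁ = solve-∀
    eq₂ : ∀ x y s m → x + y + (s + x * m) ≡ y + s + x * (+ 1 + m)
    eq₂ = solve-∀

  -- The largest Σ u for which fromSlacks x u, with first entry x and last entry x + n w′ − Σ u,
  -- is not 0-allowed.
  bound : ℕ → ℕ
  bound n = n ℕ.* w′ ℕ.+ w

  private
    gap : ∀ x k s → x - + 1 - (x + k - s) + (+ 1 + k) ≡ s
    gap = solve-∀

  -- The difference tested for a wrap is Σ u - n w′ - 1; it reaches w exactly when Σ u exceeds n w′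
  -- + w.
  gap⇒bound< : ∀ x (u : Vec ℕ n) → + w ≤ x - + 1 - (x + + (n ℕ.* w′) - + sum u) → bound n ℕ.< sum u
  gap⇒bound< {n} x u p = begin
    suc (n ℕ.* w′ ℕ.+ w)   ≡⟨ ℕ.+-comm (suc (n ℕ.* w′)) w ⟩
    w ℕ.+ suc (n ℕ.* w′)   ≤⟨ ℤ.drop‿+≤+ (subst (+ w + + suc (n ℕ.* w′) ≤_) (gap x (+ (n ℕ.* w′)) (+ sum u))
                                (ℤ.+-monoˡ-≤ (+ suc (n ℕ.* w′)) p)) ⟩
    sum u                  ∎
    where open ℕ.≤-Reasoning

  bound<⇒gap : ∀ x (u : Vec ℕ n) → bound n ℕ.< sum u → + w ≤ x - + 1 - (x + + (n ℕ.* w′) - + sum u)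
  bound<⇒gap {n} x u p = begin
    + w                                    ≡⟨ eq₁ (+ w) (+ (n ℕ.* w′)) ⟩
    + suc (bound n) - (+ 1 + + (n ℕ.* w′)) ≤⟨ ℤ.+-monoˡ-≤ (- (+ 1 + + (n ℕ.* w′))) (+≤+ p) ⟩
    + sum u - (+ 1 + + (n ℕ.* w′))         ≡⟨ eq₂ x (+ (n ℕ.* w′)) (+ sum u) ⟩
    x - + 1 - (x + + (n ℕ.* w′) - + sum u) ∎
    where
    open ℤ.≤-Reasoning
    eq₁ : ∀ w k → w ≡ + 1 + (k + w) - (+ 1 + k)
    eq₁ = solve-∀
    eq₂ : ∀ x k s → s - (+ 1 + k) ≡ x - + 1 - (x + k - s)
    eq₂ = solve-∀

  fromSlacks-isNormalForm : ∀ x (u : Vec ℕ (suc n)) → sum u ℕ.≤ bound (suc n) → IsNormalForm (Step w) (fromSlacks x u)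
  fromSlacks-isNormalForm x u        _ (_ , swap s) = ¬Swap-fromSlacks x u s
  fromSlacks-isNormalForm {n} x (u ∷ us) b (_ , wrap s) with swapView w (fromSlacks _ us) s
  ... | inner s′        = ¬Swap-fromSlacks _ us s′
  -- The last entry `y` meets the lowered first entry `x - 1`; their difference is too small by the
  -- bound on Σ u.
  ... | outer v y eq p  = contradiction b (ℕ.<⇒≱ (gap⇒bound< {suc n} x (u ∷ us) (subst (λ t → + w ≤ x - + 1 - t) y≡ p)))
    where
    y≡ : y ≡ x + + (suc n ℕ.* w′) - + sum (u ∷ us)
    y≡ = trans (sym (last-∷ʳ y v)) (trans (cong last (sym eq)) (last-fromSlacks x (u ∷ us)))

  isNormalForm⇒fromSlacks : ∀ (c : Vec ℤ (suc (suc n))) → IsNormalForm (Step w) c →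
                       ∃₂ λ x u → c ≡ fromSlacks x u × sum u ℕ.≤ bound (suc n)
  isNormalForm⇒fromSlacks {n} (x ∷ v) nf with ¬Swap⇒fromSlacks x v (λ (_ , s) → nf (_ , swap s))
  ... | u ∷ us , refl = x , u ∷ us , refl , ℕ.≮⇒≥ ¬bound<
    where
    y = x + + w′ - + u
    -- Beyond the bound, the last entry `z` and the lowered first entry `x - 1` could be
    -- interchanged after the shift, giving a wrap from an irreducible vector.
    ¬bound< : ¬ bound (suc n) ℕ.< sum (u ∷ us)
    ¬bound< b with initLast (fromSlacks y us) in eq
    ... | t , z , eq′ = nf (_ , wrap (subst (λ c → Swap w (c ∷ʳ (x - + 1)) (t ∷ʳ (x - + 1) ∷ʳ z)) (sym eq′)
           (Swap-last w t (subst (λ l → + w ≤ x - + 1 - l)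
             (trans (sym (last-fromSlacks x (u ∷ us))) (cong (proj₁ ∘ proj₂) eq))
             (bound<⇒gap x (u ∷ us) b)))))

-- Counting irreducible vectors by coordinate sum

module _ (n w′ : ℕ) where

  private
    p w : ℕ
    p = suc (suc n)
    w = suc w′

  NF : Vec ℤ p → Set
  NF = IsNormalForm (Step w)

  NF-ρ : ∀ {c} → NF c → NF (ρ c)
  NF-ρ {c} nf (d , s) = nf (_ , subst (λ t → Step w t (σ d)) (σ∘ρ c) (Step-σ w s))

  NF-σ : ∀ {c} → NF c → NF (σ c)
  NF-σ {c} nf (d , s) = nf (_ , subst (λ t → Step w t (ρ d)) (ρ∘σ c) (Step-ρ w s))

  sumℤ-fromSlacks₀ : ∀ x (u : Vec ℕ (suc n)) → sumℤ (fromSlacks w′ x u) ≡ sumℤ (fromSlacks w′ (+ 0) u) + x * + p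
  sumℤ-fromSlacks₀ x u = trans (cong (λ y → sumℤ (fromSlacks w′ y u)) (sym (ℤ.+-identityʳ x)))
    (sumℤ-fromSlacks w′ x (+ 0) u)

  -- Subtracting the quotient from every entry leaves the remainder modulo p as coordinate sum. This
  -- picks the one translate with sum in {0, ..., p - 1}.
  balance : Vec ℕ (suc n) → Vec ℤ p
  balance u = fromSlacks w′ (- (sumℤ (fromSlacks w′ (+ 0) u) /ℕ p)) u

  sumℤ-balance : ∀ u → sumℤ (balance u) ≡ + (sumℤ (fromSlacks w′ (+ 0) u) %ℕ p)
  sumℤ-balance u = begin
    sumℤ (balance u)                           ≡⟨ sumℤ-fromSlacks₀ (- (s /ℕ p)) u ⟩
    s + - (s /ℕ p) * + p                       ≡⟨ cong (λ t → t + - (s /ℕ p) * + p) (a≡a%ℕn+[a/ℕn]*n s p) ⟩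
    + (s %ℕ p) + s /ℕ p * + p + - (s /ℕ p) * + p ≡⟨ eq (+ (s %ℕ p)) (s /ℕ p) (+ p) ⟩
    + (s %ℕ p)                                 ∎
    where
    open ≡-Reasoning
    s = sumℤ (fromSlacks w′ (+ 0) u)
    eq : ∀ r q p → r + q * p + - q * p ≡ r
    eq = solve-∀

  fromSlacks≡balance : ∀ {k} x u → k ℕ.< p → sumℤ (fromSlacks w′ x u) ≡ + k → fromSlacks w′ x u ≡ balance u
  fromSlacks≡balance {k} x u k<p sum≡k = cong (λ y → fromSlacks w′ y u) (ℤ.i-j≡0⇒i≡j x y
    (quotient-unique p (x - y) (n%ℕd<d s p) k<p (begin
      + (s %ℕ p) + (x - y) * + p            ≡⟨ cong (λ t → t + (x - y) * + p) (sumℤ-balance u) ⟨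
      sumℤ (balance u) + (x - y) * + p      ≡⟨ cong (λ t → t + (x - y) * + p) (sumℤ-fromSlacks₀ y u) ⟩
      s + y * + p + (x - y) * + p           ≡⟨ eq s x y (+ p) ⟩
      s + x * + p                           ≡⟨ sumℤ-fromSlacks₀ x u ⟨
      sumℤ (fromSlacks w′ x u)              ≡⟨ sum≡k ⟩
      + k                                   ∎)))
    where
    open ≡-Reasoning
    s = sumℤ (fromSlacks w′ (+ 0) u)
    y = - (s /ℕ p)
    eq : ∀ s x y p → s + y * p + (x - y) * p ≡ s + x * p
    eq = solve-∀

  -- The suffix `<p` refers to the coordinate sum: these are the irreducible vectors with sum in {0,
  -- ..., p - 1}, one for each admissible slack vector.
  normalForms<p : List (Vec ℤ p)
  normalForms<p = map balance (boundedVecs (suc n) (bound w′ (suc n)))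

  length-normalForms<p : length normalForms<p ≡ (p ℕ.* w) C suc n
  length-normalForms<p = begin
    length normalForms<p                            ≡⟨ length-map balance (boundedVecs (suc n) (bound w′ (suc n))) ⟩
    length (boundedVecs (suc n) (bound w′ (suc n))) ≡⟨ length-boundedVecs (suc n) (bound w′ (suc n)) ⟩
    (bound w′ (suc n) ℕ.+ suc n) C suc n            ≡⟨ cong (_C suc n) (eq n w′) ⟩
    (p ℕ.* w) C suc n                               ∎
    where
    open ≡-Reasoning
    eq : ∀ n w′ → suc n ℕ.* w′ ℕ.+ suc w′ ℕ.+ suc n ≡ suc (suc n) ℕ.* suc w′
    eq = ℕ.solve-∀

  normalForms<p-unique : Unique normalForms<p
  normalForms<p-unique = Unique.map⁺ (λ {u} {v} eq → proj₂ (fromSlacks-injective w′ u v eq))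
    (boundedVecs-unique (suc n) (bound w′ (suc n)))

  ∈-normalForms<p⁺ : ∀ {c k} → NF c → sumℤ c ≡ + k → k ℕ.< p → c ∈ normalForms<p
  ∈-normalForms<p⁺ {c} nf sum≡k k<p with isNormalForm⇒fromSlacks w′ c nf
  ... | x , u , refl , b =
    subst (_∈ normalForms<p) (sym (fromSlacks≡balance x u k<p sum≡k)) (∈-map⁺ balance (∈-boundedVecs⁺ u b))

  ∈-normalForms<p⁻ : ∀ {c} → c ∈ normalForms<p → NF c × ∃ λ k → sumℤ c ≡ + k × k ℕ.< p
  ∈-normalForms<p⁻ i with ∈-map⁻ balance i
  ... | u , j , refl = fromSlacks-isNormalForm w′ _ u (∈-boundedVecs⁻ (suc n) (bound w′ (suc n)) j)
                     , _ , sumℤ-balance u , n%ℕd<d (sumℤ (fromSlacks w′ (+ 0) u)) p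

  normalForms₀ : List (Vec ℤ p)
  normalForms₀ = filter (λ c → sumℤ c ℤ.≟ + 0) normalForms<p

  normalForms₀-unique : Unique normalForms₀
  normalForms₀-unique = Unique.filter⁺ (λ c → sumℤ c ℤ.≟ + 0) normalForms<p-unique

  ∈-normalForms₀⁺ : ∀ {c} → NF c → sumℤ c ≡ + 0 → c ∈ normalForms₀
  ∈-normalForms₀⁺ nf eq = ∈-filter⁺ (λ c → sumℤ c ℤ.≟ + 0) (∈-normalForms<p⁺ nf eq ℕ.z<s) eq

  ∈-normalForms₀⁻ : ∀ {c} → c ∈ normalForms₀ → NF c × sumℤ c ≡ + 0
  ∈-normalForms₀⁻ i with ∈-filter⁻ (λ c → sumℤ c ℤ.≟ + 0) {xs = normalForms<p} i
  ... | j , eq = proj₁ (∈-normalForms<p⁻ j) , eq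

  -- The irreducible vectors with coordinate sum in {0, …, k − 1}.
  rotations : ℕ → List (Vec ℤ p)
  rotations zero    = []
  rotations (suc k) = normalForms₀ ++ map σ (rotations k)

  length-rotations : ∀ k → length (rotations k) ≡ k ℕ.* length normalForms₀
  length-rotations zero    = refl
  length-rotations (suc k) = trans (length-++ normalForms₀)
    (cong (length normalForms₀ ℕ.+_) (trans (length-map σ (rotations k)) (length-rotations k)))

  ∈-rotations⁻ : ∀ k {c} → c ∈ rotations k → NF c × ∃ λ j → sumℤ c ≡ + j × j ℕ.< k
  ∈-rotations⁻ (suc k) i with ∈-++⁻ normalForms₀ i
  ... | inj₁ i₀ with ∈-normalForms₀⁻ i₀
  ...   | nf , eq = nf , 0 , eq , ℕ.z<s
  ∈-rotations⁻ (suc k) i | inj₂ i₁ with ∈-map⁻ σ i₁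
  ... | c , i₂ , refl with ∈-rotations⁻ k i₂
  ...   | nf , j , eq , j<k = NF-σ nf , suc j
    , trans (sumℤ-σ c) (trans (cong (λ t → t + + 1) eq) (cong +_ (ℕ.+-comm j 1))) , ℕ.s<s j<k

  -- Induction on the sum: for positive sum, c is `σ` of `ρ c`, which is again irreducible and has
  -- sum one less.
  ∈-rotations⁺ : ∀ k {c j} → NF c → sumℤ c ≡ + j → j ℕ.< k → c ∈ rotations k
  ∈-rotations⁺ (suc k) {j = zero}      nf eq _           = ∈-++⁺ˡ (∈-normalForms₀⁺ nf eq)
  ∈-rotations⁺ (suc k) {c} {j = suc j} nf eq (ℕ.s<s j<k) = ∈-++⁺ʳ normalForms₀
    (subst (_∈ map σ (rotations k)) (σ∘ρ c)
      (∈-map⁺ σ (∈-rotations⁺ k (NF-ρ nf) (trans (sumℤ-ρ c) (cong (λ t → t - + 1) eq)) j<k)))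

  -- Members of `normalForms₀` have sum 0 while the shifted ones have positive sum, so no vector is
  -- listed twice.
  rotations-unique : ∀ k → Unique (rotations k)
  rotations-unique zero    = []
  rotations-unique (suc k) = Unique.++⁺ normalForms₀-unique (Unique.map⁺ σ-injective (rotations-unique k)) disjoint
    where
    disjoint : Disjoint normalForms₀ (map σ (rotations k))
    disjoint (i , j) with ∈-map⁻ σ j
    ... | c , j′ , refl with ∈-rotations⁻ k j′
    ...   | _ , m , eq , _ = contradiction
      (trans (sym (proj₂ (∈-normalForms₀⁻ i))) (trans (sumℤ-σ c) (trans (cong (λ t → t + + 1) eq) (cong +_ (ℕ.+-comm m 1)))))
      λ ()

  -- A double count: `rotations p` and `normalForms<p` are duplicate-free and have the same members,
  -- so each is a permutation of the other.
  p*length-normalForms₀ : p ℕ.* length normalForms₀ ≡ (p ℕ.* w) C suc n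
  p*length-normalForms₀ = begin
    p ℕ.* length normalForms₀     ≡⟨ length-rotations p ⟨
    length (rotations p)          ≡⟨ ↭-length (∼bag⇒↭ (unique∧set⇒bag (rotations-unique p) normalForms<p-unique
                               (mk⇔ (λ i → let nf , _ , eq , lt = ∈-rotations⁻ p i in ∈-normalForms<p⁺ nf eq lt)
                                    (λ i → let nf , _ , eq , lt = ∈-normalForms<p⁻ i in ∈-rotations⁺ p nf eq lt)))) ⟩
    length normalForms<p          ≡⟨ length-normalForms<p ⟩
    (p ℕ.* w) C suc n             ∎
    where open ≡-Reasoning

  -- Irreducible vectors of sum zero represent the Scopes families

  sumℤ-Step* : ∀ {c d : Vec ℤ p} → Star (Step w) c d → sumℤ c ≡ sumℤ d
  sumℤ-Step* ε        = refl
  sumℤ-Step* (s ◅ ss) = trans (sumℤ-Step w s) (sumℤ-Step* ss)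

  -- Equivalent irreducible vectors coincide by uniqueness of normal forms. Rewriting any c of sum 0
  -- to its normal form preserves the sum and thus ends in the list.
  normalForms₀-numScopesFamilies : NumScopesFamilies p w (length normalForms₀)
  normalForms₀-numScopesFamilies = lookup normalForms₀ , inC , separate , cover
    where
    inC : ∀ a → InC p (lookup normalForms₀ a)
    inC a = proj₂ (∈-normalForms₀⁻ (∈-lookup a))
    separate : ∀ a b → ScopesEquiv p w (lookup normalForms₀ a) (lookup normalForms₀ b) → a ≡ b
    separate a b eq = unique⇒lookup-injective normalForms₀-unique a b
      (Step-uniqueNormalForm w′ (proj₁ (∈-normalForms₀⁻ (∈-lookup a))) (proj₁ (∈-normalForms₀⁻ (∈-lookup b)))
        (EqClosure.map (ScStep⇒Step w) eq))
    cover : ∀ c → InC p c → ∃[ a ] ScopesEquiv p w c (lookup normalForms₀ a)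
    cover c c∈C with Step-weaklyNormalizing w′ c
    ... | d , nf , ss = index i , subst (ScopesEquiv p w c) (lookup-index i)
                                    (Star.map (fwd ∘ Step⇒ScStep w) ss)
      where
      i : d ∈ normalForms₀
      i = ∈-normalForms₀⁺ nf (trans (sym (sumℤ-Step* ss)) c∈C)

theorem4p12 : (p w : ℕ) → Prime p → 1 ℕ.≤ w →
    ∃[ N ] (NumScopesFamilies p w N × p ℕ.* N ≡ (p ℕ.* w) C (p ℕ.∸ 1))
theorem4p12 (suc (suc n)) (suc w′) _ _ =
  length (normalForms₀ n w′) , normalForms₀-numScopesFamilies n w′ , p*length-normalForms₀ n w′
theorem4p12 zero          _        pr _ = contradiction pr ¬prime[0]
theorem4p12 (suc zero)    _        pr _ = contradiction pr ¬prime[1]
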